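{- Let $H = (V, A, B)$ be a cross-intersecting family. Suppose that $A$ and $B$ both have minimal elements of $E = A \cup B$, i.e. there are $a \in A$ and $b \in B$ such that $a$ and $b$ both have no subedge in $H$ (no edge $e \in A \cup B$ satisfies $e \subsetneq a$, and no edge $e \in A \cup B$ satisfies $e \subsetneq b$). Then $\chi(H) \leq 4$.
   Context: A hypergraph is a pair $(V,E)$ where $V$ is a set of vertices and $E$ is a set of subsets of $V$ (edges). A cross-intersecting family $H = (V, A, B)$ is a hypergraph with vertex set $V$ and edge set $E = A \cup B$ such that every $a \in A$ intersects every $b \in B$, and $A$, $B$ are not empty. A coloring of the vertices is proper if there are no monochromatic edges; the chromatic number $\chi(H)$ is the minimal number of colors that admits a proper coloring. -}

module Defs where

open import Level using (Level; _⊔_) renaming (suc to lsuc)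
open import Data.Fin using (Fin)
open import Data.Nat using (ℕ; _≤_)
open import Data.Product using (_×_; Σ-syntax)
open import Relation.Binary.PropositionalEquality using (_≡_)
open import Relation.Nullary using (¬_)
open import Relation.Unary using (Pred; _∈_; _∪_; _⊂_; _≬_; Satisfiable)

-- Subsets of V are predicates.  No finiteness is imposed on V, on the edges
-- or on the number of edges.  E need not respect extensional equality of
-- predicates; the notions below depend on edges only through membership, so
-- closing E under extensional equality does not affect them.
record Hypergraph (v e f : Level) : Set (lsuc (v ⊔ e ⊔ f)) where
  field
    V : Set v
    E : Pred (Pred V e) f

module _ {v e f : Level} (H : Hypergraph v e f) where
  open Hypergraph H

  Monochromatic : ∀ {ℓ} {C : Set ℓ} → (V → C) → Pred V e → Set (v ⊔ e ⊔ ℓ)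
  Monochromatic c s = ∀ {x y} → x ∈ s → y ∈ s → c x ≡ c y

  Proper : ∀ {ℓ} {C : Set ℓ} → (V → C) → Set (v ⊔ lsuc e ⊔ f ⊔ ℓ)
  Proper c = ∀ {s} → s ∈ E → ¬ Monochromatic c s

  -- A proper coloring with some set of colors, possibly infinite, exists.
  -- This is what it takes for the chromatic number to be defined at all: an
  -- edge with at most one vertex is monochromatic in every coloring.
  Colorable : Set (lsuc v ⊔ lsuc e ⊔ f)
  Colorable = Σ[ C ∈ Set v ] Σ[ c ∈ (V → C) ] Proper c

  ProperlyColorableWith : ℕ → Set (v ⊔ lsuc e ⊔ f)
  ProperlyColorableWith k = Σ[ c ∈ (V → Fin k) ] Proper c

  IsChromaticNumber : ℕ → Set (v ⊔ lsuc e ⊔ f)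
  IsChromaticNumber k =
    ProperlyColorableWith k × (∀ m → ProperlyColorableWith m → k ≤ m)

  NoSubedge : Pred V e → Set (v ⊔ lsuc e ⊔ f)
  NoSubedge s = ∀ {t} → t ∈ E → ¬ (t ⊂ s)

record CrossIntersectingFamily (v e f : Level) : Set (lsuc (v ⊔ e ⊔ f)) where
  field
    V              : Set v
    A B            : Pred (Pred V e) f
    A-nonempty     : Satisfiable A
    B-nonempty     : Satisfiable B
    crossIntersect : ∀ {a b} → a ∈ A → b ∈ B → a ≬ b

  hypergraph : Hypergraph v e f
  hypergraph = record { V = V ; E = A ∪ B }

{-# OPTIONS --safe #-}

-- Pick minimal edges a ∈ A and b ∈ B and a common vertex x, and partition the
-- vertices into {x}, a ∖ {x}, b ∖ a and the rest.  No edge lies in one part: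
-- one contained in {x} would be monochromatic in every coloring, one contained
-- in a ∖ {x} or b ∖ a would be a proper subedge of a or b, and the last part
-- misses both a and b, while every edge meets one of them.
module Submission where

open import Axiom.ExcludedMiddle using (ExcludedMiddle)
open import Data.Fin using (Fin)
open import Data.Fin.Patterns using (0F; 1F; 2F; 3F)
open import Data.Nat using (ℕ; _≤_; _<_)
open import Data.Nat.Induction using (<-rec)
open import Data.Nat.Properties using (≤-refl; ≤-trans; <⇒≤; ≮⇒≥)
open import Data.Product using (_×_; _,_; proj₁; proj₂; ∃-syntax)
open import Data.Sum using (_⊎_; inj₁; inj₂)
open import Level using (_⊔_)
open import Relation.Binary.PropositionalEquality using (_≡_; _≢_; refl; sym; trans; cong; subst)
open import Relation.Nullary using (¬_; yes; no)
open import Relation.Unary using (Pred; _∈_; _∉_; _⊆_; _≬_)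
open import Defs

-- Strong induction: excluded middle either finds a smaller witness to recurse on or shows that `n`
-- itself is least. The bound by the starting witness is carried along so that a proper coloring
-- with 4 colors bounds the chromatic number at once.
least : (∀ {ℓ} → ExcludedMiddle ℓ) → ∀ {p} (P : Pred ℕ p) {n} → P n →
        ∃[ k ] ((P k × (∀ m → P m → k ≤ m)) × k ≤ n)
least em P {n} = <-rec (λ n → P n → ∃[ k ] ((P k × (∀ m → P m → k ≤ m)) × k ≤ n)) step n
  where
  step : ∀ n → (∀ {m} → m < n → P m → ∃[ k ] ((P k × (∀ m → P m → k ≤ m)) × k ≤ m)) →
         P n → ∃[ k ] ((P k × (∀ m → P m → k ≤ m)) × k ≤ n)
  step n rec Pn with em {P = ∃[ m ] (m < n × P m)}
  ... | no ∄m = n , (Pn , λ m Pm → ≮⇒≥ λ m<n → ∄m (m , m<n , Pm)) , ≤-refl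
  ... | yes (m , m<n , Pm) with rec m<n Pm
  ...   | k , least-k , k≤m = k , least-k , ≤-trans k≤m (<⇒≤ m<n)

module _ {v e f} (H : Hypergraph v e f) where
  open Hypergraph H

  -- A vertex of `s` outside `t` makes the inclusion strict, which minimality forbids. Below, that
  -- vertex is always the common vertex of `a` and `b`.
  subedge-misses-nothing : ∀ {s t x} → NoSubedge H s → t ∈ E → t ⊆ s → x ∈ s → ¬ x ∉ t
  subedge-misses-nothing minimal t∈E t⊆s x∈s x∉t = minimal t∈E (t⊆s , λ s⊆t → x∉t (s⊆t x∈s))

  no-singleton-edge : Colorable H → ∀ {s x} → s ∈ E → ¬ (∀ {y} → y ∈ s → y ≡ x)
  no-singleton-edge (_ , c , proper) s∈E s⊆｛x｝ =
    proper s∈E λ y∈s z∈s → cong c (trans (s⊆｛x｝ y∈s) (sym (s⊆｛x｝ z∈s)))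

  module _ (a b : Pred V e) (x : V) where

    -- Indexing by the color makes each color class a predicate `Part i`, so that a monochromatic
    -- edge becomes a subset of a single class.
    data Part : Fin 4 → V → Set (v ⊔ e) where
      centre  : ∀ {y} → y ≡ x → Part 0F y
      rest-a  : ∀ {y} → y ≢ x → y ∈ a → Part 1F y
      rest-b  : ∀ {y} → y ∉ a → y ∈ b → Part 2F y
      outside : ∀ {y} → y ∉ a → y ∉ b → Part 3F y

    part : (∀ {ℓ} → ExcludedMiddle ℓ) → ∀ y → ∃[ i ] Part i y
    part em y with em {P = y ≡ x} | em {P = y ∈ a} | em {P = y ∈ b}
    ... | yes y≡x | _       | _       = 0F , centre y≡x
    ... | no y≢x  | yes y∈a | _       = 1F , rest-a y≢x y∈a
    ... | no _    | no y∉a  | yes y∈b = 2F , rest-b y∉a y∈b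
    ... | no _    | no y∉a  | no y∉b  = 3F , outside y∉a y∉b

    no-edge-in-part : Colorable H → NoSubedge H a → NoSubedge H b → x ∈ a → x ∈ b →
                      ∀ {s} → s ∈ E → s ≬ a ⊎ s ≬ b → ∀ i → ¬ (s ⊆ Part i)
    no-edge-in-part colorable _ _ _ _ s∈E _ 0F s⊆ =
      no-singleton-edge colorable s∈E λ y∈s → case-centre (s⊆ y∈s)
      where
      case-centre : ∀ {y} → Part 0F y → y ≡ x
      case-centre (centre y≡x) = y≡x
    no-edge-in-part _ a-min _ x∈a _ {s} s∈E _ 1F s⊆ =
      subedge-misses-nothing a-min s∈E (λ y∈s → in-a (s⊆ y∈s)) x∈a λ x∈s → not-x (s⊆ x∈s)
      where
      in-a : Part 1F ⊆ a
      in-a (rest-a _ y∈a) = y∈a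
      not-x : ¬ Part 1F x
      not-x (rest-a x≢x _) = x≢x refl
    -- This class excludes all of `a`, hence also `x`, so the same vertex shows that the inclusion
    -- in `b` is strict.
    no-edge-in-part _ _ b-min x∈a x∈b s∈E _ 2F s⊆ =
      subedge-misses-nothing b-min s∈E (λ y∈s → in-b (s⊆ y∈s)) x∈b λ x∈s → not-x (s⊆ x∈s)
      where
      in-b : Part 2F ⊆ b
      in-b (rest-b _ y∈b) = y∈b
      not-x : ¬ Part 2F x
      not-x (rest-b x∉a _) = x∉a x∈a
    no-edge-in-part _ _ _ _ _ _ (inj₁ (y , y∈s , y∈a)) 3F s⊆ with s⊆ y∈s
    ... | outside y∉a _ = y∉a y∈a
    no-edge-in-part _ _ _ _ _ _ (inj₂ (y , y∈s , y∈b)) 3F s⊆ with s⊆ y∈s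
    ... | outside _ y∉b = y∉b y∈b

    four-colorable : (∀ {ℓ} → ExcludedMiddle ℓ) → Colorable H →
                     NoSubedge H a → NoSubedge H b → x ∈ a → x ∈ b →
                     (∀ {s} → s ∈ E → s ≬ a ⊎ s ≬ b) → ProperlyColorableWith H 4
    four-colorable em colorable a-min b-min x∈a x∈b meets = color , proper
      where
      color : V → Fin 4
      color y = proj₁ (part em y)

      -- A vertex of the edge is needed to name its color: `Monochromatic` only equates the colors
      -- of pairs, and holds vacuously for an empty edge.
      vertex : ∀ {s} → s ≬ a ⊎ s ≬ b → ∃[ y ] y ∈ s
      vertex (inj₁ (y , y∈s , _)) = y , y∈s
      vertex (inj₂ (y , y∈s , _)) = y , y∈s

      proper : Proper H color
      proper s∈E mono with vertex (meets s∈E)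
      ... | y , y∈s =
        no-edge-in-part colorable a-min b-min x∈a x∈b s∈E (meets s∈E) (color y)
          λ {z} z∈s → subst (λ i → Part i z) (mono z∈s y∈s) (proj₂ (part em z))

proposition1p4 : (∀ {ℓ} → ExcludedMiddle ℓ) →
    ∀ {v e f} (H : CrossIntersectingFamily v e f) →
    let open CrossIntersectingFamily H in
    Colorable hypergraph →
    (∃[ a ] (a ∈ A × NoSubedge hypergraph a)) →
    (∃[ b ] (b ∈ B × NoSubedge hypergraph b)) →
    ∃[ k ] (IsChromaticNumber hypergraph k × k ≤ 4)
proposition1p4 em H colorable (a , a∈A , a-min) (b , b∈B , b-min)
  with CrossIntersectingFamily.crossIntersect H a∈A b∈B
... | x , x∈a , x∈b =
  least em (ProperlyColorableWith hypergraph)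
    (four-colorable hypergraph a b x em colorable a-min b-min x∈a x∈b meets)
  where
  open CrossIntersectingFamily H
  meets : ∀ {s} → s ∈ Hypergraph.E hypergraph → s ≬ a ⊎ s ≬ b
  -- The sides cross over: an edge from `A` is tested against `b`, and one from `B` against `a`.
  meets (inj₁ s∈A) = inj₂ (crossIntersect s∈A b∈B)
  meets (inj₂ s∈B) with crossIntersect a∈A s∈B
  ... | y , y∈a , y∈s = inj₁ (y , y∈s , y∈a)
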